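{- Let $k\ge 2$ be an integer. There exist an integer $p_0(k)$ and a constant $C=C(k)>0$ such that for every prime $p>p_0(k)$, $$p^{1/k}-1\le f^{(D)}(p,k)\le C(p\log p)^{1/k}.$$
   Context: For a finite abelian group $G$ (written additively) and a non-empty set $A\subseteq\mathbb{Z}\setminus\{0\}$, the weighted Davenport constant $D_A(G)$ is the least positive integer $k$ such that for every sequence $(x_1,\ldots,x_k)$ of elements of $G$ there exist a non-empty subsequence $(x_{i_1},\ldots,x_{i_t})$ and elements $a_1,\ldots,a_t\in A$ with $\sum_{j=1}^t a_jx_{i_j}=0$ (here $ax$ is the $a$-fold sum of $x$ for $a>0$ and $ax=(-a)(-x)$ for $a<0$). For $G$ of exponent $n$ and an integer $k\ge 2$, $f^{(D)}_G(k):=\min\{|A|:\emptyset\ne A\subseteq[1,n-1],\ D_A(G)\le k\}$, with $f^{(D)}_G(k)=\infty$ if no such $A$ exists. For the cyclic group $\mathbb{Z}_n$ write $f^{(D)}(n,k):=f^{(D)}_{\mathbb{Z}_n}(k)$. Here $[a,b]=\{a,a+1,\ldots,b\}$. -}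

module Defs where

open import Data.Nat using (ℕ; zero; suc; _+_; _*_; _≤_; NonZero)
open import Data.Nat.DivMod using (_%_)
open import Data.Fin using (Fin; toℕ)
open import Data.Fin.Subset using (Subset; _∈_; _∉_; ∣_∣; Nonempty)
open import Data.Product using (Σ; ∃; _×_; _,_)
open import Relation.Binary.PropositionalEquality using (_≡_)
open import Relation.Nullary.Decidable using (⌊_⌋)
open import Data.Fin.Subset.Properties using (_∈?_)

sumFin : {k : ℕ} → (Fin k → ℕ) → ℕ
sumFin {zero}  f = 0
sumFin {suc k} f = f Fin.zero + sumFin (λ i → f (Fin.suc i))

-- A weight set A ⊆ [1, n-1] is encoded as a subset of Fin n (residues 0..n-1)
-- not containing 0.  An element x of ℤ_n is an element of Fin n.

weightedSum : {n k : ℕ} → Subset k → (Fin k → ℕ) → (Fin k → Fin n) → ℕ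
weightedSum S a x = sumFin (λ i → if ⌊ i ∈? S ⌋ then a i * toℕ (x i) else 0)
  where open import Data.Bool using (if_then_else_)

HasWeightedZeroSum : (n : ℕ) .{{_ : NonZero n}} → Subset n → (k : ℕ) → (Fin k → Fin n) → Set
HasWeightedZeroSum n A k x =
  Σ (Subset k) λ S → Nonempty S ×
    Σ (Fin k → ℕ) λ a →
      ((i : Fin k) → i ∈ S → Σ (Fin n) λ w → (w ∈ A) × (toℕ w ≡ a i)) ×
      (weightedSum S a x % n ≡ 0)

Admissible : (n : ℕ) .{{_ : NonZero n}} → Subset n → ℕ → Set
Admissible n A k = (x : Fin k → Fin n) → HasWeightedZeroSum n A k x

-- D_A(ℤ_n) ≤ k : the least positive admissible integer is ≤ k,
-- i.e. some positive k' ≤ k is admissible.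
DA≤ : (n : ℕ) .{{_ : NonZero n}} → Subset n → ℕ → Set
DA≤ n A k = Σ ℕ λ k' → (1 ≤ k') × (k' ≤ k) × Admissible n A k'

ValidWeights : (n : ℕ) → Subset n → Set
ValidWeights n A = Nonempty A × ((z : Fin n) → toℕ z ≡ 0 → z ∉ A)

-- f^{(D)}(n,k) = m  (in particular finite):
-- m is the minimum of |A| over valid A with D_A(ℤ_n) ≤ k.
fD≡ : (n : ℕ) .{{_ : NonZero n}} → ℕ → ℕ → Set
fD≡ n k m =
  (Σ (Subset n) λ A → ValidWeights n A × DA≤ n A k × (∣ A ∣ ≡ m)) ×
  ((A : Subset n) → ValidWeights n A → DA≤ n A k → m ≤ ∣ A ∣)

{-# OPTIONS --safe #-}
-- Lower bound: the relations over A ∪ {0} come from at most (|A| + 1)^k coefficient vectors, and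
-- fewer than p non-zero vectors over ℤ_p cannot meet the orthogonal complement of every x.
-- Upper bound: take A = {±1, …, ±r} with r = ⌊p^{1/k}⌋. The (r + 1)^k > p sums Σ cᵢ xᵢ with
-- 0 ≤ cᵢ ≤ r cannot be distinct mod p, and the difference of two equal ones is a relation over
-- A ∪ {0} (Thue's argument). Hence f ≤ 2 p^{1/k}, without the logarithm.
-- The minimum exists constructively because D_A ≤ k is decidable by finite search.
module Submission where

open import Defs
open import Data.Nat using (ℕ; zero; suc; _+_; _*_; _^_; _∸_; _≤_; _<_; z≤n; s≤s; s≤s⁻¹; NonZero; >-nonZero)
open import Data.Nat.Primality using (Prime; euclidsLemma)
open import Data.Nat.Logarithm using (⌊log₂_⌋; ⌊log₂⌋-mono-≤)
open import Data.Nat.Properties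
open import Data.Nat.DivMod
open import Data.Nat.Divisibility
open import Data.Nat.Induction using (<-wellFounded)
open import Data.Nat.Tactic.RingSolver using (solve-∀)
open import Induction.WellFounded using (Acc; acc)
open import Data.Bool using (if_then_else_)
open import Data.Fin as Fin using (Fin; toℕ; fromℕ<; finToFun; funToFin)
open import Data.Fin.Properties as Fin using (toℕ<n; toℕ-fromℕ<; toℕ-injective; all?; any?; pigeonhole; ¬∀⟶∃¬; finToFun-funToFin; funToFin-finToFin)
open import Data.Fin.Subset using (Subset; inside; outside; _∈_; _∉_; ∣_∣; ⊥; ⁅_⁆; _∪_)
open import Data.Fin.Subset.Properties using (_∈?_; anySubset?; nonempty?; ∉⊥; ∣⊥∣≡0; ∣⁅x⁆∣≡1; x∈⁅x⁆; x∈⁅y⁆⇒x≡y; x∈p∪q⁺; x∈p∪q⁻)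
open import Data.Product using (Σ; ∃; ∃-syntax; _×_; _,_; proj₁; proj₂)
open import Data.Sum using (_⊎_; inj₁; inj₂; map₁; map₂; [_,_]′)
open import Data.Vec using ([]; _∷_; here; there; tabulate)
open import Data.Vec.Properties using (lookup∘tabulate; lookup⇒[]=; []=⇒lookup)
open import Function using (_∘_)
open import Relation.Binary.Definitions using (tri<; tri≈; tri>)
open import Relation.Binary.PropositionalEquality
open import Relation.Nullary using (Dec; yes; no; ¬_; contradiction)
open import Relation.Nullary.Decidable using (⌊_⌋; map′; _×-dec_; _⊎-dec_; _→-dec_; ¬?)

-- Linear forms and congruences modulo `n`.

dot : ∀ {k} → (Fin k → ℕ) → (Fin k → ℕ) → ℕ
dot u x = sumFin (λ i → u i * x i)

sumFin-cong : ∀ {k} {f g : Fin k → ℕ} → f ≗ g → sumFin f ≡ sumFin g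
sumFin-cong {zero}  f≗g = refl
sumFin-cong {suc k} f≗g = cong₂ _+_ (f≗g Fin.zero) (sumFin-cong (f≗g ∘ Fin.suc))

+-cong-% : ∀ n .{{_ : NonZero n}} {a b c d} →
           a % n ≡ b % n → c % n ≡ d % n → (a + c) % n ≡ (b + d) % n
+-cong-% n {a} {b} {c} {d} a≡b c≡d = begin
  (a + c) % n          ≡⟨ %-distribˡ-+ a c n ⟩
  (a % n + c % n) % n  ≡⟨ cong₂ (λ s t → (s + t) % n) a≡b c≡d ⟩
  (b % n + d % n) % n  ≡⟨ %-distribˡ-+ b d n ⟨
  (b + d) % n          ∎
  where open ≡-Reasoning

*-congʳ-% : ∀ n .{{_ : NonZero n}} {a b} c → a % n ≡ b % n → (a * c) % n ≡ (b * c) % n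
*-congʳ-% n {a} {b} c a≡b = begin
  (a * c) % n              ≡⟨ %-distribˡ-* a c n ⟩
  ((a % n) * (c % n)) % n  ≡⟨ cong (λ s → (s * (c % n)) % n) a≡b ⟩
  ((b % n) * (c % n)) % n  ≡⟨ %-distribˡ-* b c n ⟨
  (b * c) % n              ∎
  where open ≡-Reasoning

-- After division with remainder the common remainder cancels. For `a < b` the truncated difference
-- is zero, and the quotient `a / n ∸ b / n` truncates along with it.
%-≡⇒∣∸ : ∀ n .{{_ : NonZero n}} a b → a % n ≡ b % n → n ∣ a ∸ b
%-≡⇒∣∸ n a b a≡b = divides (a / n ∸ b / n) (begin
  a ∸ b                                          ≡⟨ cong₂ _∸_ (m≡m%n+[m/n]*n a n) (m≡m%n+[m/n]*n b n) ⟩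
  (a % n + a / n * n) ∸ (b % n + b / n * n)      ≡⟨ cong (λ r → (r + a / n * n) ∸ (b % n + b / n * n)) a≡b ⟩
  (b % n + a / n * n) ∸ (b % n + b / n * n)      ≡⟨ [m+n]∸[m+o]≡n∸o (b % n) _ _ ⟩
  a / n * n ∸ b / n * n                          ≡⟨ *-distribʳ-∸ n (a / n) (b / n) ⟨
  (a / n ∸ b / n) * n                            ∎)
  where open ≡-Reasoning

-- `b` plays the role of `u - v`; with `v` moved across, everything stays in `ℕ`.
dot-+-% : ∀ n .{{_ : NonZero n}} {k} (b v u x : Fin k → ℕ) →
          (∀ i → (b i + v i) % n ≡ u i % n) → (dot b x + dot v x) % n ≡ dot u x % n
dot-+-% n {zero}  b v u x b+v≡u = refl
dot-+-% n {suc k} b v u x b+v≡u = begin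
  (b₀ * x₀ + B + (v₀ * x₀ + V)) % n  ≡⟨ cong (_% n) (interchange b₀ v₀ x₀ B V) ⟩
  ((b₀ + v₀) * x₀ + (B + V)) % n     ≡⟨ +-cong-% n (*-congʳ-% n x₀ (b+v≡u Fin.zero))
                                          (dot-+-% n (b ∘ Fin.suc) (v ∘ Fin.suc) (u ∘ Fin.suc)
                                                     (x ∘ Fin.suc) (b+v≡u ∘ Fin.suc)) ⟩
  dot u x % n                        ∎
  where
  open ≡-Reasoning
  b₀ = b Fin.zero
  v₀ = v Fin.zero
  x₀ = x Fin.zero
  B = dot (b ∘ Fin.suc) (x ∘ Fin.suc)
  V = dot (v ∘ Fin.suc) (x ∘ Fin.suc)
  interchange : ∀ b v x s t → b * x + s + (v * x + t) ≡ (b + v) * x + (s + t)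
  interchange = solve-∀

toℕ-0mod : ∀ n .{{_ : NonZero n}} → toℕ (0 mod n) ≡ 0
toℕ-0mod n = trans (toℕ-fromℕ< _) (m*n%n≡0 0 n)

-- Weighted zero sums as linear relations.

-- The selected index set and the weights are merged into one coefficient vector over
-- A ∪ {0}; the zero coefficients mark the indices that are left out.
IsRelation : (n : ℕ) .{{_ : NonZero n}} → Subset n → ∀ {k} → (x b : Fin k → Fin n) → Set
IsRelation n A x b =
  (∀ i → b i ∈ A ⊎ toℕ (b i) ≡ 0) × (∃[ i ] b i ∈ A) × dot (toℕ ∘ b) (toℕ ∘ x) % n ≡ 0

module _ {n : ℕ} .{{_ : NonZero n}} {A : Subset n} {k : ℕ} {x : Fin k → Fin n} where

  relation⇒zeroSum : (∃[ b ] IsRelation n A x b) → HasWeightedZeroSum n A k x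
  relation⇒zeroSum (b , b∈A∪0 , (i , bᵢ∈A) , b·x≡0) =
    S , (i , ∈S⁺ bᵢ∈A) , toℕ ∘ b , (λ j j∈S → b j , ∈S⁻ j∈S , refl) ,
    trans (cong (_% n) (sumFin-cong term)) b·x≡0
    where
    S : Subset k
    S = tabulate (λ j → ⌊ b j ∈? A ⌋)
    ∈S⁺ : ∀ {j} → b j ∈ A → j ∈ S
    ∈S⁺ {j} bⱼ∈A = lookup⇒[]= j S (trans (lookup∘tabulate _ j) eq)
      where
      eq : ⌊ b j ∈? A ⌋ ≡ inside
      eq with b j ∈? A
      ... | yes _    = refl
      ... | no bⱼ∉A = contradiction bⱼ∈A bⱼ∉A
    ∈S⁻ : ∀ {j} → j ∈ S → b j ∈ A
    ∈S⁻ {j} j∈S with b j ∈? A | trans (sym (lookup∘tabulate (λ j → ⌊ b j ∈? A ⌋) j)) ([]=⇒lookup j∈S)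
    ... | yes bⱼ∈A | _ = bⱼ∈A
    term : ∀ j → (if ⌊ j ∈? S ⌋ then toℕ (b j) * toℕ (x j) else 0) ≡ toℕ (b j) * toℕ (x j)
    term j with j ∈? S | b∈A∪0 j
    ... | yes _   | _          = refl
    ... | no j∉S | inj₁ bⱼ∈A = contradiction (∈S⁺ bⱼ∈A) j∉S
    ... | no _    | inj₂ bⱼ≡0 = cong (_* toℕ (x j)) (sym bⱼ≡0)

  zeroSum⇒relation : HasWeightedZeroSum n A k x → ∃[ b ] IsRelation n A x b
  zeroSum⇒relation (S , (i , i∈S) , a , weight , ax≡0) =
    proj₁ ∘ coeff , map₂ proj₁ ∘ shape , (i , bᵢ∈A) , trans (cong (_% n) (sumFin-cong term)) ax≡0
    where
    -- Weights at indices outside `S` are arbitrary, so zero replaces them. Whether `j` lies in `S`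
    -- is recorded, to be matched with the decision inside `weightedSum`.
    coeff : ∀ j → Σ (Fin n) λ c → (c ∈ A × j ∈ S × toℕ c ≡ a j) ⊎ (toℕ c ≡ 0 × j ∉ S)
    coeff j with j ∈? S
    ... | yes j∈S = let w , w∈A , w≡a = weight j j∈S in w , inj₁ (w∈A , j∈S , w≡a)
    ... | no j∉S  = 0 mod n , inj₂ (toℕ-0mod n , j∉S)
    shape : ∀ j → proj₁ (coeff j) ∈ A ⊎ (toℕ (proj₁ (coeff j)) ≡ 0 × j ∉ S)
    shape j = map₁ proj₁ (proj₂ (coeff j))
    bᵢ∈A : proj₁ (coeff i) ∈ A
    bᵢ∈A with shape i
    ... | inj₁ bᵢ∈A     = bᵢ∈A
    ... | inj₂ (_ , i∉S) = contradiction i∈S i∉S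
    term : ∀ j → toℕ (proj₁ (coeff j)) * toℕ (x j) ≡ (if ⌊ j ∈? S ⌋ then a j * toℕ (x j) else 0)
    term j = evaluate (proj₁ (coeff j)) (proj₂ (coeff j)) (j ∈? S)
      where
      evaluate : ∀ c → (c ∈ A × j ∈ S × toℕ c ≡ a j) ⊎ (toℕ c ≡ 0 × j ∉ S) → (j∈?S : Dec (j ∈ S)) →
                 toℕ c * toℕ (x j) ≡ (if ⌊ j∈?S ⌋ then a j * toℕ (x j) else 0)
      evaluate c (inj₁ (_ , _ , c≡a)) (yes _)   = cong (_* toℕ (x j)) c≡a
      evaluate c (inj₁ (_ , j∈S , _)) (no j∉S)  = contradiction j∈S j∉S
      evaluate c (inj₂ (_ , j∉S))     (yes j∈S) = contradiction j∈S j∉S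
      evaluate c (inj₂ (c≡0 , _))     (no _)    = cong (_* toℕ (x j)) c≡0

-- Decidability and existence of the minimum.

module _ {m n : ℕ} {P : (Fin m → Fin n) → Set}
         (resp : ∀ {f g} → f ≗ g → P f → P g) (P? : ∀ f → Dec (P f)) where

  -- Functions are searched through their codes in `Fin (n ^ m)`. Decoding a code returns the
  -- function only pointwise, whence the hypothesis `resp`.
  anyFun? : Dec (∃ P)
  anyFun? = map′ (λ (j , Pj) → finToFun j , Pj)
                 (λ (f , Pf) → funToFin f , resp (sym ∘ finToFun-funToFin f) Pf)
                 (any? (P? ∘ finToFun))

  allFun? : Dec (∀ f → P f)
  allFun? = map′ (λ all f → resp (finToFun-funToFin f) (all (funToFin f)))
                 (λ all → all ∘ finToFun)
                 (all? (P? ∘ finToFun))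

module _ (n : ℕ) .{{_ : NonZero n}} (A : Subset n) where

  isRelation-resp : ∀ {k} {x y b c : Fin k → Fin n} → x ≗ y → b ≗ c →
                    IsRelation n A x b → IsRelation n A y c
  isRelation-resp x≗y b≗c (b∈A∪0 , (i , bᵢ∈A) , b·x≡0) =
    (λ j → subst (λ z → z ∈ A ⊎ toℕ z ≡ 0) (b≗c j) (b∈A∪0 j)) ,
    (i , subst (_∈ A) (b≗c i) bᵢ∈A) ,
    trans (cong (_% n) (sumFin-cong λ j → cong₂ (λ s t → toℕ s * toℕ t) (sym (b≗c j)) (sym (x≗y j)))) b·x≡0

  isRelation? : ∀ {k} (x b : Fin k → Fin n) → Dec (IsRelation n A x b)
  isRelation? x b = all? (λ i → (b i ∈? A) ⊎-dec (toℕ (b i) ≟ 0))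
    ×-dec any? (λ i → b i ∈? A) ×-dec (dot (toℕ ∘ b) (toℕ ∘ x) % n ≟ 0)

  -- A zero sum involves a weight function into `ℕ`, which no finite search exhausts. A relation is
  -- a vector over `Fin n`, so both quantifiers range over finitely many functions.
  admissible? : ∀ k → Dec (Admissible n A k)
  admissible? k = map′ (λ all x → relation⇒zeroSum (all x)) (λ adm x → zeroSum⇒relation (adm x))
    (allFun? (λ x≗y (b , rel) → b , isRelation-resp x≗y (λ _ → refl) rel)
             (λ x → anyFun? (isRelation-resp (λ _ → refl)) (isRelation? x)))

  DA≤? : ∀ k → Dec (DA≤ n A k)
  DA≤? k = map′ (λ (k' , k'<1+k , 1≤k' , adm) → k' , 1≤k' , s≤s⁻¹ k'<1+k , adm)
                (λ (k' , 1≤k' , k'≤k , adm) → k' , s≤s k'≤k , 1≤k' , adm)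
                (anyUpTo? (λ k' → (1 ≤? k') ×-dec admissible? k') (suc k))

  validWeights? : Dec (ValidWeights n A)
  validWeights? = nonempty? A ×-dec all? (λ z → (toℕ z ≟ 0) →-dec ¬? (z ∈? A))

-- Descent on cardinality: as long as the search finds a smaller set with `P`, pass to it.
minimalSubset : ∀ {n} {P : Subset n → Set} → (∀ A → Dec (P A)) → ∀ A → P A →
                ∃[ B ] (P B × (∀ C → P C → ∣ B ∣ ≤ ∣ C ∣))
minimalSubset {n} {P} P? A PA = descend A PA (<-wellFounded ∣ A ∣)
  where
  descend : ∀ B → P B → Acc _<_ ∣ B ∣ → ∃[ B ] (P B × (∀ C → P C → ∣ B ∣ ≤ ∣ C ∣))
  descend B PB (acc smaller) with anySubset? (λ C → P? C ×-dec (∣ C ∣ <? ∣ B ∣))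
  ... | yes (C , PC , C<B) = descend C PC (smaller C<B)
  ... | no ∄C              = B , PB , λ C PC → ≮⇒≥ λ C<B → ∄C (C , PC , C<B)

-- Lower bound: counting coefficient vectors.

enumerate : ∀ {n} (A : Subset n) → Fin ∣ A ∣ → Fin n
enumerate (inside  ∷ A) Fin.zero    = Fin.zero
enumerate (inside  ∷ A) (Fin.suc i) = Fin.suc (enumerate A i)
enumerate (outside ∷ A) i           = Fin.suc (enumerate A i)

enumerate-surjective : ∀ {n} (A : Subset n) {z} → z ∈ A → ∃[ i ] enumerate A i ≡ z
enumerate-surjective (inside  ∷ A) here        = Fin.zero , refl
enumerate-surjective (inside  ∷ A) (there z∈A) =
  let i , eq = enumerate-surjective A z∈A in Fin.suc i , cong Fin.suc eq
enumerate-surjective (outside ∷ A) (there z∈A) =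
  let i , eq = enumerate-surjective A z∈A in i , cong Fin.suc eq

-- The extra index stands for the coefficient zero; it is the source of the `+ 1` in the lower
-- bound.
enumerate₀ : ∀ n .{{_ : NonZero n}} (A : Subset n) → Fin (suc ∣ A ∣) → Fin n
enumerate₀ n A Fin.zero    = 0 mod n
enumerate₀ n A (Fin.suc i) = enumerate A i

enumerate₀-surjective : ∀ n .{{_ : NonZero n}} (A : Subset n) {z} →
                        z ∈ A ⊎ toℕ z ≡ 0 → ∃[ i ] enumerate₀ n A i ≡ z
enumerate₀-surjective n A (inj₁ z∈A) =
  let i , eq = enumerate-surjective A z∈A in Fin.suc i , eq
enumerate₀-surjective n A (inj₂ z≡0) =
  Fin.zero , toℕ-injective (trans (toℕ-0mod n) (sym z≡0))

-- Subtracting the two values leaves `p ∣ a * (y ∸ x)`, where both factors lie strictly between 0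
-- and `p`.
affine-root-unique : ∀ {p} → Prime p → ∀ {a s x y} → 0 < a → a < p → x < y → y < p →
                     p ∣ a * x + s → ¬ p ∣ a * y + s
affine-root-unique {p} pp {a} {s} {x} {y} 0<a a<p x<y y<p p∣ax+s p∣ay+s
  with euclidsLemma a (y ∸ x) pp (∣m+n∣m⇒∣n (subst (p ∣_) split p∣ay+s) p∣ax+s)
  where
  open ≡-Reasoning
  split : a * y + s ≡ a * x + s + a * (y ∸ x)
  split = begin
    a * y + s                  ≡⟨ cong (λ t → a * t + s) (m+[n∸m]≡n (<⇒≤ x<y)) ⟨
    a * (x + (y ∸ x)) + s      ≡⟨ rearrange a x (y ∸ x) s ⟩
    a * x + s + a * (y ∸ x)    ∎
    where
    rearrange : ∀ a x d s → a * (x + d) + s ≡ a * x + s + a * d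
    rearrange = solve-∀
... | inj₁ p∣a   = >⇒∤ {{>-nonZero 0<a}} a<p p∣a
... | inj₂ p∣y-x = >⇒∤ {{>-nonZero (m<n⇒0<n∸m x<y)}} (≤-<-trans (m∸n≤m y x) y<p) p∣y-x

-- Each vector with nonzero head forbids at most one value of the head of x, and the vectors
-- with zero head are dealt with by the tail; hence fewer than p vectors leave a value over.
avoid : ∀ {p} → Prime p → ∀ {N} → N < p → ∀ {k} (L : Fin N → Fin k → Fin p) →
        Σ (Fin k → Fin p) λ x → ∀ j → (∃[ i ] 0 < toℕ (L j i)) → ¬ p ∣ dot (toℕ ∘ L j) (toℕ ∘ x)
avoid pp N<p {zero}  L = (λ ()) , λ { j (() , _) }
avoid {p} pp {N} N<p {suc k} L = x , ok
  where
  tail = avoid pp N<p (λ j → L j ∘ Fin.suc)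
  a s : Fin N → ℕ
  a j = toℕ (L j Fin.zero)
  s j = dot (toℕ ∘ L j ∘ Fin.suc) (toℕ ∘ proj₁ tail)
  Bad : Fin p → Fin N → Set
  Bad t j = 0 < a j × p ∣ a j * toℕ t + s j
  bad? : ∀ t → Dec (∃ (Bad t))
  bad? t = any? (λ j → (0 <? a j) ×-dec (p ∣? a j * toℕ t + s j))
  ¬allBad : ¬ (∀ t → ∃ (Bad t))
  ¬allBad bad with pigeonhole N<p (proj₁ ∘ bad)
  ... | t , t' , t<t' , same =
    affine-root-unique pp (proj₁ (proj₂ (bad t))) (toℕ<n (L (proj₁ (bad t)) Fin.zero)) t<t' (toℕ<n t')
      (proj₂ (proj₂ (bad t))) (proj₂ (subst (Bad t') (sym same) (proj₂ (bad t'))))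
  head = ¬∀⟶∃¬ p (∃ ∘ Bad) bad? ¬allBad
  x : Fin (suc k) → Fin p
  x Fin.zero    = proj₁ head
  x (Fin.suc i) = proj₁ tail i
  ok : ∀ j → (∃[ i ] 0 < toℕ (L j i)) → ¬ p ∣ dot (toℕ ∘ L j) (toℕ ∘ x)
  -- In the `zero` case the type of `p∣` computes to divisibility of `s j`, which the tail excludes.
  ok j nz p∣ with a j in aⱼ≡
  ok j nz                p∣ | suc _ = proj₂ head (j , subst (0 <_) (sym aⱼ≡) (s≤s z≤n) ,
    subst (λ c → p ∣ c * toℕ (proj₁ head) + s j) (sym aⱼ≡) p∣)
  ok j (Fin.zero  , 0<a) p∣ | zero  = contradiction (subst (0 <_) aⱼ≡ 0<a) λ ()
  ok j (Fin.suc i , 0<a) p∣ | zero  = proj₂ tail j (i , 0<a) p∣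

-- With fewer than `p` coefficient vectors, `avoid` would give an `x` orthogonal to none of the
-- nonzero ones, yet admissibility yields a relation for that `x`. The count is made at the
-- admissible length `k'` and then raised to `k`.
lowerBound : ∀ {p} .{{_ : NonZero p}} → Prime p → ∀ k (A : Subset p) →
             ValidWeights p A → DA≤ p A k → p ≤ (∣ A ∣ + 1) ^ k
lowerBound {p} pp k A (_ , 0∉A) (k' , 1≤k' , k'≤k , adm) = begin
  p                   ≤⟨ ≮⇒≥ impossible ⟩
  suc ∣ A ∣ ^ k'      ≤⟨ ^-monoʳ-≤ (suc ∣ A ∣) k'≤k ⟩
  suc ∣ A ∣ ^ k       ≡⟨ cong (_^ k) (+-comm 1 ∣ A ∣) ⟩
  (∣ A ∣ + 1) ^ k     ∎
  where
  open ≤-Reasoning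
  L : Fin (suc ∣ A ∣ ^ k') → Fin k' → Fin p
  L j = enumerate₀ p A ∘ finToFun j
  impossible : ¬ suc ∣ A ∣ ^ k' < p
  impossible small =
    -- A coefficient in `A` is nonzero, so the relation is one of the vectors that `x` avoids.
    proj₂ avoided j (i , n≢0⇒n>0 λ Lᵢ≡0 → 0∉A _ (trans (cong toℕ (sym (L≗b i))) Lᵢ≡0) bᵢ∈A)
      (m%n≡0⇒n∣m _ p (trans (cong (_% p) (sumFin-cong λ i → cong (λ z → toℕ z * toℕ (x i)) (L≗b i))) b·x≡0))
    where
    avoided = avoid pp small L
    x = proj₁ avoided
    relation = zeroSum⇒relation (adm x)
    b = proj₁ relation
    b∈A∪0 = proj₁ (proj₂ relation)
    i = proj₁ (proj₁ (proj₂ (proj₂ relation)))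
    bᵢ∈A = proj₂ (proj₁ (proj₂ (proj₂ relation)))
    b·x≡0 = proj₂ (proj₂ (proj₂ relation))
    -- Each entry of `b` is located among zero and the elements of `A`; together these indices code
    -- the position of `b` in the list `L`.
    c = λ i → enumerate₀-surjective p A (b∈A∪0 i)
    j = funToFin (proj₁ ∘ c)
    L≗b : L j ≗ b
    L≗b i = trans (cong (enumerate₀ p A) (finToFun-funToFin (proj₁ ∘ c) i)) (proj₂ (c i))

-- Upper bound: small residues and Thue's argument.

∣p∪q∣≤∣p∣+∣q∣ : ∀ {n} (p q : Subset n) → ∣ p ∪ q ∣ ≤ ∣ p ∣ + ∣ q ∣
∣p∪q∣≤∣p∣+∣q∣ []            []            = z≤n
∣p∪q∣≤∣p∣+∣q∣ (inside  ∷ p) (inside  ∷ q) = s≤s (≤-trans (∣p∪q∣≤∣p∣+∣q∣ p q) (+-monoʳ-≤ ∣ p ∣ (n≤1+n _)))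
∣p∪q∣≤∣p∣+∣q∣ (inside  ∷ p) (outside ∷ q) = s≤s (∣p∪q∣≤∣p∣+∣q∣ p q)
∣p∪q∣≤∣p∣+∣q∣ (outside ∷ p) (inside  ∷ q) = ≤-trans (s≤s (∣p∪q∣≤∣p∣+∣q∣ p q)) (≤-reflexive (sym (+-suc ∣ p ∣ ∣ q ∣)))
∣p∪q∣≤∣p∣+∣q∣ (outside ∷ p) (outside ∷ q) = ∣p∪q∣≤∣p∣+∣q∣ p q

range : ∀ {N n} → (Fin N → Fin n) → Subset n
range {zero}  g = ⊥
range {suc N} g = ⁅ g Fin.zero ⁆ ∪ range (g ∘ Fin.suc)

∣range∣≤ : ∀ {N n} (g : Fin N → Fin n) → ∣ range g ∣ ≤ N
∣range∣≤ {zero}  {n} g = ≤-reflexive (∣⊥∣≡0 n)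
∣range∣≤ {suc N} g = ≤-trans (∣p∪q∣≤∣p∣+∣q∣ ⁅ g Fin.zero ⁆ _)
  (+-mono-≤ (≤-reflexive (∣⁅x⁆∣≡1 (g Fin.zero))) (∣range∣≤ (g ∘ Fin.suc)))

∈range⁺ : ∀ {N n} (g : Fin N → Fin n) i → g i ∈ range g
∈range⁺ g Fin.zero    = x∈p∪q⁺ (inj₁ (x∈⁅x⁆ _))
∈range⁺ g (Fin.suc i) = x∈p∪q⁺ (inj₂ (∈range⁺ (g ∘ Fin.suc) i))

∈range⁻ : ∀ {N n} (g : Fin N → Fin n) {z} → z ∈ range g → ∃[ i ] z ≡ g i
∈range⁻ {zero}  g z∈ = contradiction z∈ ∉⊥
∈range⁻ {suc N} g z∈ with x∈p∪q⁻ ⁅ g Fin.zero ⁆ _ z∈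
... | inj₁ z∈₀ = Fin.zero , x∈⁅y⁆⇒x≡y _ z∈₀
... | inj₂ z∈₊ = let i , eq = ∈range⁻ (g ∘ Fin.suc) z∈₊ in Fin.suc i , eq

funToFin-cong : ∀ {m n} {f g : Fin m → Fin n} → f ≗ g → funToFin f ≡ funToFin g
funToFin-cong {zero}  f≗g = refl
funToFin-cong {suc m} f≗g = cong₂ Fin.combine (f≗g Fin.zero) (funToFin-cong (f≗g ∘ Fin.suc))

-- Turns the distinct codes given by the pigeonhole principle into vectors that differ in some
-- coordinate.
finToFun-injective : ∀ m {n} {i j : Fin (n ^ m)} → finToFun {n} {m} i ≗ finToFun j → i ≡ j
finToFun-injective m {n} {i} {j} i≗j = begin
  i                              ≡⟨ funToFin-finToFin {m} {n} i ⟨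
  funToFin (finToFun {n} {m} i)  ≡⟨ funToFin-cong i≗j ⟩
  funToFin (finToFun {n} {m} j)  ≡⟨ funToFin-finToFin {m} {n} j ⟩
  j                              ∎
  where open ≡-Reasoning

module SmallResidues (n : ℕ) .{{_ : NonZero n}} (r : ℕ) (r<n : r < n) where

  -- `neg i` represents the weight `-(i + 1)` by its residue; the shift by one keeps zero out, as
  -- `r < n`.
  pos neg : Fin r → Fin n
  pos i = suc (toℕ i) mod n
  neg i = (n ∸ suc (toℕ i)) mod n

  ±[1,r] : Subset n
  ±[1,r] = range pos ∪ range neg

  -- Only an inequality: positive and negative residues may coincide, as for `n = 2`, `r = 1`.
  ∣±[1,r]∣≤ : ∣ ±[1,r] ∣ ≤ r + r
  ∣±[1,r]∣≤ = ≤-trans (∣p∪q∣≤∣p∣+∣q∣ (range pos) (range neg)) (+-mono-≤ (∣range∣≤ pos) (∣range∣≤ neg))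

  suc<n : ∀ (i : Fin r) → suc (toℕ i) < n
  suc<n i = ≤-<-trans (toℕ<n i) r<n

  toℕ-pos : ∀ i → toℕ (pos i) ≡ suc (toℕ i)
  toℕ-pos i = trans (toℕ-fromℕ< _) (m<n⇒m%n≡m (suc<n i))

  toℕ-neg : ∀ i → toℕ (neg i) ≡ n ∸ suc (toℕ i)
  toℕ-neg i = trans (toℕ-fromℕ< _) (m<n⇒m%n≡m (∸-monoʳ-< (s≤s z≤n) (<⇒≤ (suc<n i))))

  0∉±[1,r] : ∀ z → toℕ z ≡ 0 → z ∉ ±[1,r]
  0∉±[1,r] z z≡0 z∈ with x∈p∪q⁻ (range pos) (range neg) z∈
  ... | inj₁ z∈pos = let i , z≡ = ∈range⁻ pos z∈pos in
    contradiction (trans (sym (toℕ-pos i)) (trans (cong toℕ (sym z≡)) z≡0)) λ ()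
  ... | inj₂ z∈neg = let i , z≡ = ∈range⁻ neg z∈neg in
    >⇒≢ (m<n⇒0<n∸m (suc<n i)) (trans (sym (toℕ-neg i)) (trans (cong toℕ (sym z≡)) z≡0))

  -- Two integers in `[0, r]` differ by at most `r` in absolute value. The zero case keeps `u ≡ v`,
  -- so that distinct vectors yield a nontrivial relation.
  difference : ∀ u v → u ≤ r → v ≤ r →
               Σ (Fin n) λ b → (b ∈ ±[1,r] ⊎ (toℕ b ≡ 0 × u ≡ v)) × (toℕ b + v) % n ≡ u % n
  difference u v u≤r v≤r with <-cmp u v
  ... | tri≈ _ u≡v _ = 0 mod n , inj₂ (0≡ , u≡v) , cong (_% n) (trans (cong (_+ v) 0≡) (sym u≡v))
    where 0≡ = toℕ-0mod n
  ... | tri> _ _ v<u = pos i , inj₁ (x∈p∪q⁺ (inj₁ (∈range⁺ pos i))) ,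
    cong (_% n) (trans (cong (_+ v) (trans (toℕ-pos i) (cong suc (toℕ-fromℕ< _)))) eq)
    where
    eq : suc (u ∸ suc v) + v ≡ u
    eq = trans (sym (+-suc (u ∸ suc v) v)) (m∸n+n≡m v<u)
    i = fromℕ< {u ∸ suc v} (<-≤-trans (∸-monoʳ-< (s≤s z≤n) v<u) u≤r)
  -- Here `v - u = d + 1`, so `neg i` is `n - (v - u)`, and adding `v` overshoots `u` by exactly
  -- `n`.
  ... | tri< u<v _ _ = neg i , inj₁ (x∈p∪q⁺ (inj₂ (∈range⁺ neg i))) ,
    trans (cong (_% n) eq) ([m+n]%n≡m%n u n)
    where
    d = v ∸ suc u
    d<r : d < r
    d<r = <-≤-trans (∸-monoʳ-< (s≤s z≤n) u<v) v≤r
    i = fromℕ< d<r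
    open ≡-Reasoning
    eq : toℕ (neg i) + v ≡ u + n
    eq = begin
      toℕ (neg i) + v               ≡⟨ cong (_+ v) (trans (toℕ-neg i) (cong (λ t → n ∸ suc t) (toℕ-fromℕ< d<r))) ⟩
      n ∸ suc d + v                 ≡⟨ cong (n ∸ suc d +_) (m∸n+n≡m u<v) ⟨
      n ∸ suc d + (d + suc u)       ≡⟨ rearrange (n ∸ suc d) d u ⟩
      u + (n ∸ suc d + suc d)       ≡⟨ cong (u +_) (m∸n+n≡m (≤-trans d<r (<⇒≤ r<n))) ⟩
      u + n                         ∎
      where
      rearrange : ∀ t d u → t + (d + suc u) ≡ u + (t + suc d)
      rearrange = solve-∀

  thue : ∀ {k} → n < suc r ^ k → (x : Fin k → Fin n) → ∃[ b ] IsRelation n ±[1,r] x b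
  thue {k} n<[1+r]^k x with pigeonhole n<[1+r]^k value
    where
    value : Fin (suc r ^ k) → Fin n
    value j = dot (toℕ ∘ finToFun j) (toℕ ∘ x) mod n
  ... | j , j' , j<j' , same = b , b∈A∪0 , nontrivial , b·x≡0
    where
    u v : Fin k → Fin (suc r)
    u = finToFun j
    v = finToFun j'
    diff = λ i → difference (toℕ (u i)) (toℕ (v i)) (s≤s⁻¹ (toℕ<n (u i))) (s≤s⁻¹ (toℕ<n (v i)))
    b = proj₁ ∘ diff
    b∈A∪0 : ∀ i → b i ∈ ±[1,r] ⊎ toℕ (b i) ≡ 0
    b∈A∪0 i = map₂ proj₁ (proj₁ (proj₂ (diff i)))
    nontrivial : ∃[ i ] b i ∈ ±[1,r]
    -- The two codes differ, so some coordinate does, and there `difference` must return an element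
    -- of `±[1,r]`.
    nontrivial = let i , uᵢ≢vᵢ = ¬∀⟶∃¬ k (λ i → u i ≡ v i) (λ i → u i Fin.≟ v i)
                                   (λ u≗v → Fin.<⇒≢ j<j' (finToFun-injective k u≗v))
                 in i , [ (λ bᵢ∈A → bᵢ∈A)
                        , (λ (_ , uᵢ≡vᵢ) → contradiction (toℕ-injective uᵢ≡vᵢ) uᵢ≢vᵢ) ]′ (proj₁ (proj₂ (diff i)))
    B U V : ℕ
    B = dot (toℕ ∘ b) (toℕ ∘ x)
    U = dot (toℕ ∘ u) (toℕ ∘ x)
    V = dot (toℕ ∘ v) (toℕ ∘ x)
    U≡V : U % n ≡ V % n
    U≡V = trans (sym (toℕ-fromℕ< _)) (trans (cong toℕ same) (toℕ-fromℕ< _))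
    B+V≡V : (B + V) % n ≡ V % n
    B+V≡V = trans (dot-+-% n (toℕ ∘ b) (toℕ ∘ v) (toℕ ∘ u) (toℕ ∘ x) (proj₂ ∘ proj₂ ∘ diff)) U≡V
    b·x≡0 : B % n ≡ 0
    b·x≡0 = n∣m⇒m%n≡0 B n (subst (n ∣_) (m+n∸n≡m B V) (%-≡⇒∣∸ n (B + V) V B+V≡V))

-- Integer roots and the assembled bounds.

^-distribʳ-* : ∀ k m n → (m * n) ^ k ≡ m ^ k * n ^ k
^-distribʳ-* zero    m n = refl
^-distribʳ-* (suc k) m n = trans (cong (m * n *_) (^-distribʳ-* k m n)) (interchange m n (m ^ k) (n ^ k))
  where
  interchange : ∀ a b c d → a * b * (c * d) ≡ a * c * (b * d)
  interchange = solve-∀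

-- Induction on `n`. The root moves up by at most one, since `n < (r + 1)^k` gives
-- `n + 1 ≤ (r + 1)^k < (r + 2)^k`. The base case relies on `0 ^ k = 0`, hence `1 ≤ k`.
integerRoot : ∀ k → 1 ≤ k → ∀ n → ∃[ r ] (r ^ k ≤ n × n < suc r ^ k)
integerRoot (suc k) 1≤k zero = 0 , z≤n , m^n>0 1 (suc k)
integerRoot k@(suc _) 1≤k (suc n) with integerRoot k 1≤k n
... | r , r^k≤n , n<[1+r]^k with suc n <? suc r ^ k
...   | yes 1+n< = r , ≤-trans r^k≤n (n≤1+n n) , 1+n<
...   | no 1+n≮  = suc r , ≮⇒≥ 1+n≮ , ≤-<-trans n<[1+r]^k (^-monoˡ-< k (n<1+n (suc r)))

-- Otherwise `n * n ≤ r * r ≤ r ^ k ≤ n`. This keeps the weights up to `r` from wrapping around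
-- modulo `n`.
root<n : ∀ {k r n} → 2 ≤ k → 1 < n → r ^ k ≤ n → r < n
root<n {k} {r} {n} 2≤k 1<n r^k≤n = ≰⇒> λ n≤r → <⇒≱ n<n*n (≤-trans (n*n≤r^k n≤r) r^k≤n)
  where
  n<n*n : n < n * n
  n<n*n = subst (_< n * n) (*-identityʳ n) (*-monoʳ-< n {{>-nonZero (<⇒≤ 1<n)}} 1<n)
  open ≤-Reasoning
  n*n≤r^k : n ≤ r → n * n ≤ r ^ k
  n*n≤r^k n≤r = begin
    n * n        ≤⟨ *-mono-≤ n≤r n≤r ⟩
    r * r        ≡⟨ cong (r *_) (*-identityʳ r) ⟨
    r ^ 2        ≤⟨ ^-monoʳ-≤ r {{>-nonZero (<-≤-trans (<⇒≤ 1<n) n≤r)}} 2≤k ⟩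
    r ^ k        ∎

-- Both bounds are stated as `k`-th powers to stay in `ℕ`; the real constant is the `k`-th root of
-- `C`, up to the factor between `⌊log₂ p⌋` and `log p`.
theorem1 : (k : ℕ) → 2 ≤ k →
    Σ ℕ λ p₀ → Σ ℕ λ C →
    (p : ℕ) .{{_ : NonZero p}} → Prime p → p₀ < p →
    Σ ℕ λ m → fD≡ p k m × (p ≤ (m + 1) ^ k) × (m ^ k ≤ C * (p * ⌊log₂ p ⌋))
-- `2 ^ k` comes from the bound `2r` on the size of `±[1,r]`; for `p > 1` the floored logarithm is
-- at least 1, so it can be multiplied in.
theorem1 k 2≤k = 1 , 2 ^ k , bounds
  where
  1≤k : 1 ≤ k
  1≤k = <⇒≤ 2≤k
  bounds : (p : ℕ) .{{_ : NonZero p}} → Prime p → 1 < p →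
           Σ ℕ λ m → fD≡ p k m × (p ≤ (m + 1) ^ k) × (m ^ k ≤ 2 ^ k * (p * ⌊log₂ p ⌋))
  bounds p pp 1<p =
    ∣ B ∣ , ((B , validB , DB≤k , refl) , λ A validA DA≤k → minimal A (validA , DA≤k)) ,
    lowerBound pp k B validB DB≤k , upper
    where
    root = integerRoot k 1≤k p
    r = proj₁ root
    r^k≤p = proj₁ (proj₂ root)
    p<[1+r]^k = proj₂ (proj₂ root)
    open SmallResidues p r (root<n 2≤k 1<p r^k≤p)
    valid : ValidWeights p ±[1,r]
    -- Applied to the zero sequence, `thue` produces a coefficient in `±[1,r]`, which is therefore
    -- nonempty.
    valid = (let b , _ , (i , bᵢ∈A) , _ = thue {k} p<[1+r]^k (λ _ → 0 mod p) in b i , bᵢ∈A) , 0∉±[1,r]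
    D≤k : DA≤ p ±[1,r] k
    D≤k = k , 1≤k , ≤-refl , λ x → relation⇒zeroSum (thue p<[1+r]^k x)
    optimum = minimalSubset (λ A → validWeights? p A ×-dec DA≤? p A k) ±[1,r] (valid , D≤k)
    B = proj₁ optimum
    validB = proj₁ (proj₁ (proj₂ optimum))
    DB≤k = proj₂ (proj₁ (proj₂ optimum))
    minimal = proj₂ (proj₂ optimum)
    open ≤-Reasoning
    upper : ∣ B ∣ ^ k ≤ 2 ^ k * (p * ⌊log₂ p ⌋)
    upper = begin
      ∣ B ∣ ^ k                  ≤⟨ ^-monoˡ-≤ k (≤-trans (minimal ±[1,r] (valid , D≤k)) ∣±[1,r]∣≤) ⟩
      (r + r) ^ k                ≡⟨ cong (λ s → (r + s) ^ k) (+-identityʳ r) ⟨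
      (2 * r) ^ k                ≡⟨ ^-distribʳ-* k 2 r ⟩
      2 ^ k * r ^ k              ≤⟨ *-monoʳ-≤ (2 ^ k) r^k≤p ⟩
      2 ^ k * p                  ≡⟨ cong (2 ^ k *_) (*-identityʳ p) ⟨
      2 ^ k * (p * 1)            ≤⟨ *-monoʳ-≤ (2 ^ k) (*-monoʳ-≤ p (⌊log₂⌋-mono-≤ 1<p)) ⟩
      2 ^ k * (p * ⌊log₂ p ⌋)    ∎
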